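{- For every integer $k\ge 4$, there exists a bipartite polyhedral graph with bipartition classes of size $k$ (that is, both classes have exactly $k$ vertices) and with exactly $4k-4$ edges.
   Context: All graphs are finite and simple. A polyhedral graph is the graph (vertices and edges) of a convex three-dimensional polyhedron; equivalently, by Steinitz's theorem, a planar 3-connected graph. -}

module Defs where

open import Data.Bool using (Bool; false; T)
open import Data.Fin using (Fin; _<_)
open import Data.Fin.Subset using (Subset; _∈_; _∉_; ∁; ∣_∣)
open import Data.List using (List; []; _∷_; _∷ʳ_)
open import Data.Nat as ℕ using (ℕ)
open import Data.Product using (_×_; ∃-syntax; _,_)
open import Data.Rational using (ℚ; 0ℚ; 1ℚ; _+_; _-_; _*_; _≤_)
open import Data.Sum using (_⊎_)
open import Data.Unit using (⊤)
open import Function.Definitions using (Injective)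
open import Relation.Binary.Construct.Closure.ReflexiveTransitive using (Star)
open import Relation.Binary.PropositionalEquality using (_≡_; _≢_)
open import Relation.Nullary using (¬_)

record Graph (n : ℕ) : Set where
  field
    adj        : Fin n → Fin n → Bool
    adj-sym    : ∀ u v → adj u v ≡ adj v u
    adj-irrefl : ∀ v → adj v v ≡ false

  Adj : Fin n → Fin n → Set
  Adj u v = T (adj u v)

-- Each unordered edge {u , v} is represented exactly once, by its ordered pair
-- with u < v (both proof fields are propositions).
record Edge {n : ℕ} (G : Graph n) : Set where
  field
    src tgt  : Fin n
    src<tgt  : src < tgt
    adjacent : Graph.Adj G src tgt

-- A is one class; the other one is its complement.
IsBipartition : ∀ {n} → Graph n → Subset n → Set
IsBipartition G A =
  ∀ u v → Graph.Adj G u v → (u ∈ A × v ∈ ∁ A) ⊎ (u ∈ ∁ A × v ∈ A)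

AdjOutside : ∀ {n} → Graph n → Subset n → Fin n → Fin n → Set
AdjOutside G X u v = u ∉ X × v ∉ X × Graph.Adj G u v

-- G − X is connected.
ConnectedOutside : ∀ {n} → Graph n → Subset n → Set
ConnectedOutside G X = ∀ u v → u ∉ X → v ∉ X → Star (AdjOutside G X) u v

IsVertexConnected : ℕ → ∀ {n} → Graph n → Set
IsVertexConnected j {n} G =
  (j ℕ.< n) × (∀ (X : Subset n) → ∣ X ∣ ℕ.< j → ConnectedOutside G X)

-- Planarity is the existence of a crossing-free drawing in the plane whose edges
-- are simple polygonal arcs.  Coordinates are rational: polygonal drawings over ℝ
-- can be perturbed to rational ones, and two segments with rational endpoints that
-- meet in ℝ² also meet in ℚ², so this gives the same class of graphs.
Point : Set
Point = ℚ × ℚ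

OnSegment : Point → Point → Point → Set
OnSegment (x₁ , y₁) (x₂ , y₂) p =
  ∃[ t ] 0ℚ ≤ t × t ≤ 1ℚ ×
    p ≡ ((1ℚ - t) * x₁ + t * x₂ , (1ℚ - t) * y₁ + t * y₂)

-- Points of the polygonal path that starts at a and visits the listed points.
OnPath : Point → List Point → Point → Set
OnPath a []       p = p ≡ a
OnPath a (b ∷ bs) p = OnSegment a b p ⊎ OnPath b bs p

-- The path does not touch itself, i.e. it is homeomorphic to [0,1] (or is a point).
SimplePath : Point → List Point → Set
SimplePath a []       = ⊤
SimplePath a (b ∷ bs) =
  a ≢ b × (∀ p → OnSegment a b p → OnPath b bs p → p ≡ b) × SimplePath b bs

record PlaneDrawing {n : ℕ} (G : Graph n) : Set where
  open Edge
  field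
    pos           : Fin n → Point
    pos-injective : Injective _≡_ _≡_ pos
    bends         : Edge G → List Point

  OnArc : Edge G → Point → Set
  OnArc e = OnPath (pos (src e)) (bends e ∷ʳ pos (tgt e))

  Interior : Edge G → Point → Set
  Interior e p = OnArc e p × p ≢ pos (src e) × p ≢ pos (tgt e)

  field
    arc-simple      : ∀ e → SimplePath (pos (src e)) (bends e ∷ʳ pos (tgt e))
    avoids-vertices : ∀ e p → Interior e p → ∀ w → p ≢ pos w
    avoids-edges    : ∀ e f → e ≢ f → ∀ p → Interior e p → ¬ OnArc f p

IsPlanar : ∀ {n} → Graph n → Set
IsPlanar = PlaneDrawing

-- By Steinitz's theorem, these are the graphs of convex 3-dimensional polyhedra.
IsPolyhedral : ∀ {n} → Graph n → Set
IsPolyhedral G = IsPlanar G × IsVertexConnected 3 G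

{-# OPTIONS --safe #-}
-- The pseudo-double wheel over an even cycle c₀ … c₂ₙ₋₁, n = k − 1 ≥ 3, has two further vertices:
-- a hub joined to the odd cᵢ and a hub joined to the even cᵢ.  Parity makes it bipartite with
-- equal classes, and its 2n rim edges and 2n spokes are 4k − 4 edges in total.
--
-- At most two vertices are removed.  If one hub survives, each remaining cycle vertex is joined to
-- it or has two cycle neighbours that are, at most one of which is removed; if no hub survives,
-- the whole cycle does; if both do, one of the disjoint paths hub – c₂ᵢ – c₂ᵢ₊₁ – hub, i < 3,
-- is untouched.
--
-- The straight-line drawing puts c₁, c₂, … at (0,0), (1,0), …, the odd hub at (0,−1), the even hub
-- at (0,1) and c₀ at (−1,2).  Each open edge is described by equations and strict inequalities, and
-- these descriptions are pairwise contradictory.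
module Submission where

open import Data.Bool using (Bool; true; false; not; _∧_; _∨_; T)
open import Data.Bool.Properties as Bool using (T-∧; T-∨; T-≡; T-not-≡; T-irrelevant; ∨-comm; not-involutive; ¬-not)
open import Data.Empty using (⊥; ⊥-elim)
open import Data.Fin as Fin using (Fin; zero; suc; toℕ; #_; fromℕ; inject₁)
open import Data.Fin.Induction using (<-weakInduction)
import Data.Fin.Properties as Fin
open import Data.Fin.Relation.Unary.Top using (view; ‵fromℕ; ‵inject₁)
open import Data.Fin.Subset using (Subset; ∁; ∣_∣; _∈_; _∉_)
open import Data.Fin.Subset.Properties using (_∈?_; x∉p⇒x∈∁p; x∈p∧x≢y⇒x∈p-y; x∈p⇒∣p-x∣<∣p∣)
open import Data.List using ([]; _∷_)
open import Data.Nat as ℕ using (ℕ; zero; suc; z≤n; s≤s; s≤s⁻¹; _≡ᵇ_; ⌊_/2⌋)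
import Data.Nat.Properties as ℕ
open import Data.Nat.Solver using () renaming (module +-*-Solver to ℕ-Solver)
open import Data.Product using (_×_; _,_; proj₁; proj₂; ∃-syntax; Σ-syntax)
open import Data.Sum using (_⊎_; inj₁; inj₂)
open import Data.Vec using (tabulate)
open import Data.Vec.Properties using (lookup∘tabulate; []=⇒lookup; lookup⇒[]=)
open import Function using (_∘_; case_of_)
open import Function.Bundles using (_↔_; mk↔ₛ′; module Equivalence)
open import Function.Construct.Composition using (_↔-∘_)
open import Relation.Binary.Construct.Closure.ReflexiveTransitive using (Star; ε; _◅_; _◅◅_; reverse)
open import Relation.Binary.Definitions using (tri<; tri≈; tri>)
open import Relation.Binary.PropositionalEquality using (_≡_; _≢_; refl; sym; trans; cong; cong₂; subst; module ≡-Reasoning)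
open import Relation.Nullary using (¬_; yes; no; contradiction)
open import Relation.Nullary.Decidable using (from-no; from-yes)
open import Defs

module Drawing where

  open import Data.Rational using (ℚ; 0ℚ; 1ℚ; _+_; _-_; _*_; -_; _≤_; _<_; _<?_; positive; nonNegative)
  open import Data.Rational.Properties
  open import Data.Rational.Solver using (module +-*-Solver)
  open +-*-Solver using (solve; Polynomial; _:=_; _:+_; _:-_; _:*_; :-_; con)

  -- Rational arithmetic and vertex positions.

  2ℚ : ℚ
  2ℚ = 1ℚ + 1ℚ

  -1ℚ : ℚ
  -1ℚ = - 1ℚ

  0<1 : 0ℚ < 1ℚ
  0<1 = from-yes (0ℚ <? 1ℚ)

  0<2 : 0ℚ < 2ℚ
  0<2 = from-yes (0ℚ <? 2ℚ)

  0<p+q : ∀ {p q} → 0ℚ < p → 0ℚ < q → 0ℚ < p + q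
  0<p+q = +-mono-<

  0≤p∧0<q⇒0<p+q : ∀ {p q} → 0ℚ ≤ p → 0ℚ < q → 0ℚ < p + q
  0≤p∧0<q⇒0<p+q = +-mono-≤-<

  0<p*q : ∀ {p q} → 0ℚ < p → 0ℚ < q → 0ℚ < p * q
  0<p*q {p} {q} 0<p 0<q =
    positive⁻¹ (p * q) {{pos*pos⇒pos p {{positive 0<p}} q {{positive 0<q}}}}

  0≤p*q : ∀ {p q} → 0ℚ ≤ p → 0ℚ ≤ q → 0ℚ ≤ p * q
  0≤p*q {p} {q} 0≤p 0≤q =
    nonNegative⁻¹ (p * q) {{nonNeg*nonNeg⇒nonNeg p {{nonNegative 0≤p}} q {{nonNegative 0≤q}}}}

  infix 4 _by_
  -- Serves as a positivity certificate: an expression visibly positive comes first, and a ring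
  -- identity then turns it into the wanted one.
  _by_ : ∀ {p q} → 0ℚ < p → p ≡ q → 0ℚ < q
  0<p by refl = 0<p

  p≡q⇒p-q≡0 : ∀ {p q} → p ≡ q → p - q ≡ 0ℚ
  p≡q⇒p-q≡0 {p} refl = +-inverseʳ p

  p-q≡0⇒p≡q : ∀ {p q} → p - q ≡ 0ℚ → p ≡ q
  p-q≡0⇒p≡q {p} {q} p-q≡0 = trans (solve 2 (λ p q → p := (p :- q) :+ q) refl p q)
    (trans (cong (_+ q) p-q≡0) (+-identityˡ q))

  p≡q∧0<p-q⇒⊥ : ∀ {p q} → p ≡ q → 0ℚ < p - q → ⊥
  p≡q∧0<p-q⇒⊥ p≡q 0<p-q = <-irrefl (sym (p≡q⇒p-q≡0 p≡q)) 0<p-q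

  0<p∧0<-p⇒⊥ : ∀ {p} → 0ℚ < p → 0ℚ < - p → ⊥
  0<p∧0<-p⇒⊥ {p} 0<p 0<-p = <-irrefl refl (0<p+q 0<p 0<-p by +-inverseʳ p)

  0≤p∧p≢0⇒0<p : ∀ {p} → 0ℚ ≤ p → p ≢ 0ℚ → 0ℚ < p
  0≤p∧p≢0⇒0<p {p} 0≤p p≢0 with 0ℚ <? p
  ... | yes 0<p = 0<p
  ... | no  0≮p = ⊥-elim (p≢0 (≤-antisym (≮⇒≥ 0≮p) 0≤p))

  -- Recursive, so that `ι (suc i)` unfolds to `1ℚ + ι i` in the identities handed to the ring
  -- solver.
  ι : ℕ → ℚ
  ι zero    = 0ℚ
  ι (suc n) = 1ℚ + ι n

  0≤ι : ∀ n → 0ℚ ≤ ι n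
  0≤ι zero    = ≤-refl
  0≤ι (suc n) = +-mono-≤ (<⇒≤ 0<1) (0≤ι n)

  ι-mono-≤ : ∀ {i j} → i ℕ.≤ j → 0ℚ ≤ ι j - ι i
  ι-mono-≤ {j = j} z≤n = subst (0ℚ ≤_) (solve 1 (λ b → b := b :- con 0ℚ) refl (ι j)) (0≤ι j)
  ι-mono-≤ {suc i} {suc j} (s≤s i≤j) = subst (0ℚ ≤_)
    (solve 2 (λ a b → b :- a := (con 1ℚ :+ b) :- (con 1ℚ :+ a)) refl (ι i) (ι j)) (ι-mono-≤ i≤j)

  ι-mono-< : ∀ {i j} → i ℕ.< j → 0ℚ < ι j - ι i
  ι-mono-< {i} {j} i<j = 0≤p∧0<q⇒0<p+q (ι-mono-≤ i<j) 0<1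
    by solve 2 (λ a b → b :- (con 1ℚ :+ a) :+ con 1ℚ := b :- a) refl (ι i) (ι j)

  ι-injective : ∀ {i j} → ι i ≡ ι j → i ≡ j
  ι-injective {i} {j} eq with ℕ.<-cmp i j
  ... | tri< i<j _ _ = ⊥-elim (p≡q∧0<p-q⇒⊥ (sym eq) (ι-mono-< i<j))
  ... | tri≈ _ i≡j _ = i≡j
  ... | tri> _ _ j<i = ⊥-elim (p≡q∧0<p-q⇒⊥ eq (ι-mono-< j<i))

  ι-cancel : ∀ {i j s} → 0ℚ < s → ι i * s ≡ ι j * s → i ≡ j
  ι-cancel {s = s} 0<s eq = ι-injective (≤-antisym
    (*-cancelʳ-≤-pos s {{positive 0<s}} (≤-reflexive eq))
    (*-cancelʳ-≤-pos s {{positive 0<s}} (≤-reflexive (sym eq))))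

  -- Vertex 0 is the odd hub, vertex 1 the even hub, and vertex 2 + i the cycle vertex cᵢ.
  position : ℕ → Point
  position 0                   = 0ℚ , -1ℚ
  position 1                   = 0ℚ , 1ℚ
  position 2                   = -1ℚ , 2ℚ
  position (suc (suc (suc i))) = ι i , 0ℚ

  position-injective : ∀ u v → position u ≡ position v → u ≡ v
  position-injective 0 0 _ = refl
  position-injective 1 1 _ = refl
  position-injective 2 2 _ = refl
  position-injective (suc (suc (suc i))) (suc (suc (suc j))) eq =
    cong (3 ℕ.+_) (ι-injective (cong proj₁ eq))
  position-injective 0 1 ()
  position-injective 0 2 ()
  position-injective 0 (suc (suc (suc _))) ()
  position-injective 1 0 ()
  position-injective 1 2 ()
  position-injective 1 (suc (suc (suc _))) ()
  position-injective 2 0 ()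
  position-injective 2 1 ()
  position-injective 2 (suc (suc (suc _))) ()
  position-injective (suc (suc (suc _))) 0 ()
  position-injective (suc (suc (suc _))) 1 ()
  position-injective (suc (suc (suc _))) 2 ()

  -- Open edges as regions of the plane.

  data Level : Set where
    below level above : Level

  Height : Level → ℚ → Set
  Height below y = 0ℚ < - y
  Height level y = y ≡ 0ℚ
  Height above y = 0ℚ < y

  height-unique : ∀ {ℓ ℓ′ y} → Height ℓ y → Height ℓ′ y → ℓ ≡ ℓ′
  height-unique {below} {below} _ _ = refl
  height-unique {level} {level} _ _ = refl
  height-unique {above} {above} _ _ = refl
  height-unique {below} {level} 0<-0 refl = ⊥-elim (from-no (0ℚ <? - 0ℚ) 0<-0)
  height-unique {level} {below} refl 0<-0 = ⊥-elim (from-no (0ℚ <? - 0ℚ) 0<-0)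
  height-unique {level} {above} refl 0<0 = ⊥-elim (<-irrefl refl 0<0)
  height-unique {above} {level} 0<0 refl = ⊥-elim (<-irrefl refl 0<0)
  height-unique {below} {above} {y} 0<-y 0<y = ⊥-elim (0<p∧0<-p⇒⊥ 0<y 0<-y)
  height-unique {above} {below} {y} 0<y 0<-y = ⊥-elim (0<p∧0<-p⇒⊥ 0<y 0<-y)

  -- A planar superset of the edges on 6 + m vertices: parity plays no role in the drawing, so both
  -- hubs are joined here to every one of c₁, c₂, … .
  data Piece (m : ℕ) : Level → ℕ → ℕ → Set where
    bs     : ∀ i → Piece m below 0 (3 ℕ.+ i)
    ss     : ∀ i → Piece m level (3 ℕ.+ i) (4 ℕ.+ i)
    as     : ∀ i → i ℕ.≤ 2 ℕ.+ m → Piece m above 1 (3 ℕ.+ i)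
    at     : Piece m above 1 2
    tfirst : Piece m above 2 3
    tlast  : Piece m above 2 (5 ℕ.+ m)

  -- The line through c₀ = (−1,2) and (i,0), strictly below c₀; at i = 1 it contains the hub (0,1).
  OnRay : ℕ → Point → Set
  OnRay i (x , y) = 0ℚ < 2ℚ - y × 2ℚ * (x + 1ℚ) ≡ ι (suc i) * (2ℚ - y)

  -- The parameter of the segment is eliminated, so a point common to two regions is refuted by
  -- arithmetic in its coordinates alone.
  Region : ∀ {m ℓ u v} → Piece m ℓ u v → Point → Set
  Region     (bs i)   (x , y) = 0ℚ < - y × 0ℚ < 1ℚ + y × x ≡ ι i * (1ℚ + y)
  Region     (ss i)   (x , y) = y ≡ 0ℚ × 0ℚ < x - ι i × 0ℚ < ι (suc i) - x
  Region     (as i _) (x , y) = 0ℚ < y × 0ℚ < 1ℚ - y × x ≡ ι i * (1ℚ - y)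
  Region     at       (x , y) = 0ℚ < y - 1ℚ × OnRay 1 (x , y)
  Region     tfirst   (x , y) = 0ℚ < y × OnRay 0 (x , y)
  Region {m} tlast    (x , y) = 0ℚ < y × OnRay (2 ℕ.+ m) (x , y)

  OpenSegment : Point → Point → Point → Set
  OpenSegment (x₁ , y₁) (x₂ , y₂) p =
    ∃[ t ] 0ℚ < t × 0ℚ < 1ℚ - t ×
      p ≡ ((1ℚ - t) * x₁ + t * x₂ , (1ℚ - t) * y₁ + t * y₂)

  affine : ∀ {n} → Polynomial n → Polynomial n → Polynomial n → Polynomial n
  affine t a b = (con 1ℚ :- t) :* a :+ t :* b

  -- The parameter values 0 and 1 give exactly the ends a and b, so excluding the ends makes both
  -- bounds on t strict.
  openSegment : ∀ {a b p} → OnSegment a b p → p ≢ a → p ≢ b → OpenSegment a b p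
  openSegment {x₁ , y₁} {x₂ , y₂} {p} (t , 0≤t , t≤1 , eq) p≢a p≢b = t , 0<t , 0<1-t , eq
    where
    start : ∀ x x′ → (1ℚ - 0ℚ) * x + 0ℚ * x′ ≡ x
    start = solve 2 (λ x x′ → affine (con 0ℚ) x x′ := x) refl
    end : ∀ x x′ → (1ℚ - 1ℚ) * x + 1ℚ * x′ ≡ x′
    end = solve 2 (λ x x′ → affine (con 1ℚ) x x′ := x′) refl
    t≢0 : t ≢ 0ℚ
    t≢0 refl = p≢a (trans eq (cong₂ _,_ (start x₁ x₂) (start y₁ y₂)))
    t≢1 : t ≢ 1ℚ
    t≢1 refl = p≢b (trans eq (cong₂ _,_ (end x₁ x₂) (end y₁ y₂)))
    0≤1-t : 0ℚ ≤ 1ℚ - t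
    0≤1-t = subst (_≤ 1ℚ - t) (+-inverseʳ t) (+-monoˡ-≤ (- t) t≤1)
    0<t : 0ℚ < t
    0<t = 0≤p∧p≢0⇒0<p 0≤t t≢0
    0<1-t : 0ℚ < 1ℚ - t
    0<1-t = 0≤p∧p≢0⇒0<p 0≤1-t (λ 1-t≡0 → t≢1 (sym (p-q≡0⇒p≡q 1-t≡0)))

  openSegment-onRay : ∀ i {p} → OpenSegment (position 2) (position (3 ℕ.+ i)) p →
    0ℚ < proj₂ p × OnRay i p
  openSegment-onRay i (t , 0<t , 0<1-t , refl) =
      (0<p*q 0<1-t 0<2 by solve 1 (λ t → (con 1ℚ :- t) :* con 2ℚ := y t) refl t)
    , (0<p*q 0<t 0<2 by solve 1 (λ t → t :* con 2ℚ := con 2ℚ :- y t) refl t)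
    , solve 2 (λ t i → con 2ℚ :* (affine t (con -1ℚ) i :+ con 1ℚ)
        := (con 1ℚ :+ i) :* (con 2ℚ :- y t)) refl t (ι i)
    where
    y : ∀ {n} → Polynomial n → Polynomial n
    y t = affine t (con 2ℚ) (con 0ℚ)

  region : ∀ {m ℓ u v p} (e : Piece m ℓ u v) →
    OpenSegment (position u) (position v) p → Region e p
  region (bs i) (t , 0<t , 0<1-t , refl) =
      (0<1-t by solve 1 (λ t → con 1ℚ :- t := :- y t) refl t)
    , (0<t by solve 1 (λ t → t := con 1ℚ :+ y t) refl t)
    , solve 2 (λ t i → affine t (con 0ℚ) i := i :* (con 1ℚ :+ y t)) refl t (ι i)
    where
    y : ∀ {n} → Polynomial n → Polynomial n
    y t = affine t (con -1ℚ) (con 0ℚ)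
  region (ss i) (t , 0<t , 0<1-t , refl) =
      solve 1 (λ t → affine t (con 0ℚ) (con 0ℚ) := con 0ℚ) refl t
    , (0<t by solve 2 (λ t i → t := affine t i (con 1ℚ :+ i) :- i) refl t (ι i))
    , (0<1-t by solve 2 (λ t i → con 1ℚ :- t := (con 1ℚ :+ i) :- affine t i (con 1ℚ :+ i))
        refl t (ι i))
  region (as i _) (t , 0<t , 0<1-t , refl) =
      (0<1-t by solve 1 (λ t → con 1ℚ :- t := y t) refl t)
    , (0<t by solve 1 (λ t → t := con 1ℚ :- y t) refl t)
    , solve 2 (λ t i → affine t (con 0ℚ) i := i :* (con 1ℚ :- y t)) refl t (ι i)
    where
    y : ∀ {n} → Polynomial n → Polynomial n
    y t = affine t (con 1ℚ) (con 0ℚ)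
  region at (t , 0<t , 0<1-t , refl) =
      (0<t by solve 1 (λ t → t := y t :- con 1ℚ) refl t)
    , (0<1-t by solve 1 (λ t → con 1ℚ :- t := con 2ℚ :- y t) refl t)
    , solve 1 (λ t → con 2ℚ :* (affine t (con 0ℚ) (con -1ℚ) :+ con 1ℚ)
        := con (ι 2) :* (con 2ℚ :- y t)) refl t
    where
    y : ∀ {n} → Polynomial n → Polynomial n
    y t = affine t (con 1ℚ) (con 2ℚ)
  region tfirst onSegment = openSegment-onRay 0 onSegment
  region {m} tlast onSegment = openSegment-onRay (2 ℕ.+ m) onSegment

  -- Disjointness of the regions from each other and from the vertices.

  height : ∀ {m ℓ u v p} (e : Piece m ℓ u v) → Region e p → Height ℓ (proj₂ p)
  height (bs i)   = proj₁
  height (ss i)   = proj₁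
  height (as i _) = proj₁
  height {p = x , y} at (0<y-1 , _) =
    0<p+q 0<y-1 0<1 by solve 1 (λ y → y :- con 1ℚ :+ con 1ℚ := y) refl y
  height tfirst   = proj₁
  height tlast    = proj₁

  -- The two alternatives serve two purposes: `inj₁` separates an edge on the axis from a vertex to
  -- its right, `inj₂` from another edge.
  unitIntervals-disjoint : ∀ {i j x} → i ℕ.< j → 0ℚ < ι (suc i) - x → x ≡ ι j ⊎ 0ℚ < x - ι j → ⊥
  unitIntervals-disjoint {i} {j} i<j x<i+1 (inj₁ refl) = <-irrefl refl
    (0≤p∧0<q⇒0<p+q (ι-mono-≤ i<j) x<i+1
      by solve 2 (λ i j → (j :- (con 1ℚ :+ i)) :+ ((con 1ℚ :+ i) :- j) := con 0ℚ) refl (ι i) (ι j))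
  unitIntervals-disjoint {i} {j} {x} i<j x<i+1 (inj₂ j<x) = <-irrefl refl
    (0≤p∧0<q⇒0<p+q (ι-mono-≤ i<j) (0<p+q x<i+1 j<x)
      by solve 3 (λ i j x → (j :- (con 1ℚ :+ i)) :+ (((con 1ℚ :+ i) :- x) :+ (x :- j)) := con 0ℚ)
        refl (ι i) (ι j) x)

  -- Distinct lines through c₀ meet only there, and 0 < 2 - y excludes c₀: cancelling 2 - y in the
  -- two equations leaves i + 1 = j + 1.
  onRay-disjoint : ∀ i j → i ≢ j → ∀ {p} → OnRay i p → OnRay j p → ⊥
  onRay-disjoint _ _ i≢j (0<2-y , eq) (_ , eq′) =
    i≢j (ℕ.suc-injective (ι-cancel 0<2-y (trans (sym eq) eq′)))

  at-as-disjoint : ∀ {m i p} (i≤ : i ℕ.≤ 2 ℕ.+ m) → Region {m} at p → Region (as i i≤) p → ⊥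
  at-as-disjoint {p = x , y} _ (1<y , _) (_ , y<1 , _) = <-irrefl refl
    (0<p+q 1<y y<1 by solve 1 (λ y → (y :- con 1ℚ) :+ (con 1ℚ :- y) := con 0ℚ) refl y)

  -- Along the spoke x = i(1 - y), so 2(x + 1) - (2 - y) = 2i(1 - y) + y > 0: the spoke stays
  -- strictly to the right of the edge c₀c₁.
  tfirst-as-disjoint : ∀ {m i p} (i≤ : i ℕ.≤ 2 ℕ.+ m) →
    Region {m} tfirst p → Region (as i i≤) p → ⊥
  tfirst-as-disjoint {i = i} {p = _ , y} _ (_ , _ , onRay) (0<y , 0<1-y , refl) =
    p≡q∧0<p-q⇒⊥ onRay
    (0≤p∧0<q⇒0<p+q (0≤p*q (<⇒≤ 0<2) (0≤p*q (0≤ι i) (<⇒≤ 0<1-y))) 0<y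
      by solve 2 (λ i y → con 2ℚ :* (i :* (con 1ℚ :- y)) :+ y
        := con 2ℚ :* (i :* (con 1ℚ :- y) :+ con 1ℚ) :- con (ι 1) :* (con 2ℚ :- y)) refl (ι i) y)

  -- Along the spoke, (3 + m)(2 - y) - 2(x + 1) = 2(2 + m - i)(1 - y) + y(1 + m). The bound on i
  -- makes the first summand nonnegative, so the spoke stays strictly to the left of the closing
  -- edge.
  tlast-as-disjoint : ∀ {m i p} (i≤ : i ℕ.≤ 2 ℕ.+ m) →
    Region {m} tlast p → Region (as i i≤) p → ⊥
  tlast-as-disjoint {m} {i} {_ , y} i≤ (_ , _ , onRay) (0<y , 0<1-y , refl) =
    p≡q∧0<p-q⇒⊥ (sym onRay)
    (0≤p∧0<q⇒0<p+q
      (0≤p*q (<⇒≤ 0<2) (0≤p*q (ι-mono-≤ i≤) (<⇒≤ 0<1-y)))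
      (0<p*q 0<y (+-mono-<-≤ 0<1 (0≤ι m)))
      by solve 3 (λ i m y →
           con 2ℚ :* ((con 1ℚ :+ (con 1ℚ :+ m) :- i) :* (con 1ℚ :- y)) :+ y :* (con 1ℚ :+ m)
        := (con 1ℚ :+ (con 1ℚ :+ (con 1ℚ :+ m))) :* (con 2ℚ :- y)
           :- con 2ℚ :* (i :* (con 1ℚ :- y) :+ con 1ℚ))
        refl (ι i) (ι m) y)

  disjoint-sameLevel : ∀ {m ℓ u v u′ v′ p} (e : Piece m ℓ u v) (f : Piece m ℓ u′ v′) →
    Region e p → Region f p → u ≡ u′ × v ≡ v′
  disjoint-sameLevel (bs i) (bs j) (_ , 0<1+y , eq) (_ , _ , eq′) =
    refl , cong (3 ℕ.+_) (ι-cancel 0<1+y (trans (sym eq) eq′))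
  disjoint-sameLevel (ss i) (ss j) (_ , i<x , x<i+1) (_ , j<x , x<j+1) with ℕ.<-cmp i j
  ... | tri< i<j _ _ = ⊥-elim (unitIntervals-disjoint i<j x<i+1 (inj₂ j<x))
  ... | tri≈ _ refl _ = refl , refl
  ... | tri> _ _ j<i = ⊥-elim (unitIntervals-disjoint j<i x<j+1 (inj₂ i<x))
  disjoint-sameLevel (as i _) (as j _) (_ , 0<1-y , eq) (_ , _ , eq′) =
    refl , cong (3 ℕ.+_) (ι-cancel 0<1-y (trans (sym eq) eq′))
  disjoint-sameLevel (as i i≤) at     r s = ⊥-elim (at-as-disjoint i≤ s r)
  disjoint-sameLevel (as i i≤) tfirst r s = ⊥-elim (tfirst-as-disjoint i≤ s r)
  disjoint-sameLevel (as i i≤) tlast  r s = ⊥-elim (tlast-as-disjoint i≤ s r)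
  disjoint-sameLevel at     (as i i≤) r s = ⊥-elim (at-as-disjoint i≤ r s)
  disjoint-sameLevel tfirst (as i i≤) r s = ⊥-elim (tfirst-as-disjoint i≤ r s)
  disjoint-sameLevel tlast  (as i i≤) r s = ⊥-elim (tlast-as-disjoint i≤ r s)
  disjoint-sameLevel at     at        _ _ = refl , refl
  disjoint-sameLevel tfirst tfirst    _ _ = refl , refl
  disjoint-sameLevel tlast  tlast     _ _ = refl , refl
  disjoint-sameLevel {p = p} at tfirst (_ , r) (_ , s) =
    ⊥-elim (onRay-disjoint 1 0 (λ ()) {p} r s)
  disjoint-sameLevel {m} {p = p} at tlast (_ , r) (_ , s) =
    ⊥-elim (onRay-disjoint 1 (2 ℕ.+ m) (λ ()) {p} r s)
  disjoint-sameLevel {p = p} tfirst at (_ , r) (_ , s) =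
    ⊥-elim (onRay-disjoint 0 1 (λ ()) {p} r s)
  disjoint-sameLevel {m} {p = p} tfirst tlast (_ , r) (_ , s) =
    ⊥-elim (onRay-disjoint 0 (2 ℕ.+ m) (λ ()) {p} r s)
  disjoint-sameLevel {m} {p = p} tlast at (_ , r) (_ , s) =
    ⊥-elim (onRay-disjoint (2 ℕ.+ m) 1 (λ ()) {p} r s)
  disjoint-sameLevel {m} {p = p} tlast tfirst (_ , r) (_ , s) =
    ⊥-elim (onRay-disjoint (2 ℕ.+ m) 0 (λ ()) {p} r s)

  -- The sign of the height of a common point forces equal levels, which leaves only pairs of pieces
  -- on one level to compare.
  disjoint : ∀ {m ℓ ℓ′ u v u′ v′ p} (e : Piece m ℓ u v) (f : Piece m ℓ′ u′ v′) →
    Region e p → Region f p → u ≡ u′ × v ≡ v′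
  disjoint e f r s with refl ← height-unique (height e r) (height f s) = disjoint-sameLevel e f r s

  -- Keeps the even hub off the edges from c₀ to both its cycle neighbours, which lie on the rays 0
  -- and 2 + m.
  onRay-position1 : ∀ i → OnRay i (position 1) → i ≡ 1
  onRay-position1 i (0<2-1 , eq) = ℕ.suc-injective (ι-cancel {suc i} {2} 0<2-1 (sym eq))

  -- The height of the vertex determines the level, so only the pieces on that level remain to be
  -- excluded.
  region-avoids-positions : ∀ {m ℓ u v} (e : Piece m ℓ u v) w → ¬ Region e (position w)
  region-avoids-positions e 0 r with refl ← height-unique {ℓ′ = below} (height e r) 0<1 with e
  ... | bs i = <-irrefl refl (proj₁ (proj₂ r))
  region-avoids-positions {m} e 1 r with refl ← height-unique {ℓ′ = above} (height e r) 0<1 with e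
  ... | as i _ = <-irrefl refl (proj₁ (proj₂ r))
  ... | at = <-irrefl refl (proj₁ r)
  ... | tfirst = case onRay-position1 0 (proj₂ r) of λ ()
  ... | tlast = case onRay-position1 (2 ℕ.+ m) (proj₂ r) of λ ()
  region-avoids-positions e 2 r with refl ← height-unique {ℓ′ = above} (height e r) 0<2 with e
  ... | as i _ = from-no (0ℚ <? 1ℚ - 2ℚ) (proj₁ (proj₂ r))
  ... | at = <-irrefl refl (proj₁ (proj₂ r))
  ... | tfirst = <-irrefl refl (proj₁ (proj₂ r))
  ... | tlast = <-irrefl refl (proj₁ (proj₂ r))
  region-avoids-positions e (suc (suc (suc j))) r
    with refl ← height-unique {ℓ′ = level} (height e r) refl with e
  ... | ss i with i ℕ.<? j
  ...   | yes i<j = unitIntervals-disjoint i<j (proj₂ (proj₂ r)) (inj₁ refl)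
  ...   | no i≮j = <-irrefl refl (0≤p∧0<q⇒0<p+q (ι-mono-≤ (ℕ.≮⇒≥ i≮j)) (proj₁ (proj₂ r))
      by solve 2 (λ i j → (i :- j) :+ (j :- i) := con 0ℚ) refl (ι i) (ι j))

open Drawing
open Equivalence using (to; from)
open import Data.Nat using (_*_; _∸_; _≥_)

-- Parity and adjacency in terms of vertex numbers.

even : ℕ → Bool
even 0             = true
even 1             = false
even (suc (suc n)) = even n

even-suc : ∀ n → even (suc n) ≡ not (even n)
even-suc 0             = refl
even-suc 1             = refl
even-suc (suc (suc n)) = even-suc n

double : ℕ → ℕ
double zero    = zero
double (suc n) = suc (suc (double n))

even-double : ∀ n → even (double n) ≡ true
even-double zero    = refl
even-double (suc n) = even-double n

-- Only pairs u < v are joined; c = 0, d = 3 + m is the edge that closes the cycle.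
joins : ℕ → ℕ → ℕ → Bool
joins m 0             (suc (suc c)) = not (even c)
joins m 1             (suc (suc c)) = even c
joins m (suc (suc c)) (suc (suc d)) = (suc c ≡ᵇ d) ∨ ((c ≡ᵇ 0) ∧ (d ≡ᵇ 3 ℕ.+ m))
joins m _             _             = false

joins⇒piece : ∀ {m} u v → v ℕ.< 6 ℕ.+ m → T (joins m u v) → ∃[ ℓ ] Piece m ℓ u v
joins⇒piece 0 (suc (suc (suc i))) _ _ = below , bs i
joins⇒piece 1 2 _ _ = above , at
joins⇒piece 1 (suc (suc (suc i))) (s≤s (s≤s (s≤s i<))) _ = above , as i (s≤s⁻¹ i<)
joins⇒piece {m} (suc (suc c)) (suc (suc d)) _ h with to (T-∨ {suc c ≡ᵇ d}) h
... | inj₁ h′ with refl ← ℕ.≡ᵇ⇒≡ (suc c) d h′ with c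
...   | zero  = above , tfirst
...   | suc i = level , ss i
joins⇒piece {m} (suc (suc c)) (suc (suc d)) _ h | inj₂ h′
  with hc , hd ← to (T-∧ {c ≡ᵇ 0}) h′
  with refl ← ℕ.≡ᵇ⇒≡ c 0 hc | refl ← ℕ.≡ᵇ⇒≡ d (3 ℕ.+ m) hd = above , tlast

piece⇒< : ∀ {m ℓ u v} → Piece m ℓ u v → u ℕ.< v
piece⇒< (bs i)   = s≤s z≤n
piece⇒< (ss i)   = ℕ.≤-refl
piece⇒< (as i _) = s≤s (s≤s z≤n)
piece⇒< at       = s≤s (s≤s z≤n)
piece⇒< tfirst   = s≤s (s≤s (s≤s z≤n))
piece⇒< tlast    = s≤s (s≤s (s≤s z≤n))

-- The classes are the parities of vertex numbers: the odd hub has number 0 and the even hub number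
-- 1, so spokes flip parity as well. The evenness of m serves the closing edge, from 2 to 5 + m.
joins⇒even-flips : ∀ {m} u v → even m ≡ true → T (joins m u v) → even v ≡ not (even u)
joins⇒even-flips 0 (suc (suc c)) _ h = to T-not-≡ h
joins⇒even-flips 1 (suc (suc c)) _ h = to T-≡ h
joins⇒even-flips {m} (suc (suc c)) (suc (suc d)) m-even h with to (T-∨ {suc c ≡ᵇ d}) h
... | inj₁ h′ with refl ← ℕ.≡ᵇ⇒≡ (suc c) d h′ = even-suc c
... | inj₂ h′
  with hc , hd ← to (T-∧ {c ≡ᵇ 0}) h′
  with refl ← ℕ.≡ᵇ⇒≡ c 0 hc | refl ← ℕ.≡ᵇ⇒≡ d (3 ℕ.+ m) hd =
  trans (even-suc m) (cong not m-even)

¬T⇒≡false : ∀ {b} → ¬ T b → b ≡ false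
¬T⇒≡false {false} _  = refl
¬T⇒≡false {true}  ¬t = ⊥-elim (¬t _)

-- The graph and its straight-line drawing.

module _ (m : ℕ) where

  joinsFin : (u v : Fin (6 ℕ.+ m)) → Bool
  joinsFin u v = joins m (toℕ u) (toℕ v)

  joinsFin⇒< : ∀ u v → T (joinsFin u v) → u Fin.< v
  joinsFin⇒< u v h = piece⇒< (proj₂ (joins⇒piece (toℕ u) (toℕ v) (Fin.toℕ<n v) h))

  pseudoDoubleWheel : Graph (6 ℕ.+ m)
  pseudoDoubleWheel = record
    { adj        = λ u v → joinsFin u v ∨ joinsFin v u
    ; adj-sym    = λ u v → ∨-comm (joinsFin u v) (joinsFin v u)
    ; adj-irrefl = λ v → cong₂ _∨_ (loopless v) (loopless v)
    }
    where
    loopless : ∀ v → joinsFin v v ≡ false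
    loopless v = ¬T⇒≡false λ h → Fin.<-irrefl refl (joinsFin⇒< v v h)

  open Graph pseudoDoubleWheel public using (Adj; adj-sym)
  open Edge

  joins⇒adj : ∀ u v → T (joinsFin u v) → Adj u v
  joins⇒adj u v h = from (T-∨ {joinsFin u v}) (inj₁ h)

  adj⇒joins : ∀ {u v} → u Fin.< v → Adj u v → T (joinsFin u v)
  adj⇒joins {u} {v} u<v h with to (T-∨ {joinsFin u v}) h
  ... | inj₁ h′ = h′
  ... | inj₂ h′ = ⊥-elim (Fin.<-asym u<v (joinsFin⇒< v u h′))

  adj-swap : ∀ u v → Adj u v → Adj v u
  adj-swap u v = subst T (adj-sym u v)

  piece : ∀ (e : Edge pseudoDoubleWheel) → ∃[ ℓ ] Piece m ℓ (toℕ (src e)) (toℕ (tgt e))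
  piece e = joins⇒piece _ _ (Fin.toℕ<n (tgt e)) (adj⇒joins (src<tgt e) (adjacent e))

  edge-≡ : ∀ {e f : Edge pseudoDoubleWheel} → src e ≡ src f → tgt e ≡ tgt f → e ≡ f
  edge-≡ {record { src<tgt = p ; adjacent = a }} {record { src<tgt = q ; adjacent = b }} refl refl
    with refl ← Fin.<-irrelevant p q | refl ← T-irrelevant a b = refl

  planar : IsPlanar pseudoDoubleWheel
  planar = record
    { pos             = λ v → position (toℕ v)
    ; pos-injective   = λ eq → Fin.toℕ-injective (position-injective _ _ eq)
    ; bends           = λ _ → []
    ; arc-simple      = λ e →
        (λ eq → ℕ.<⇒≢ (src<tgt e) (position-injective _ _ eq)) , (λ _ _ p≡b → p≡b) , _
    ; avoids-vertices = avoids-vertices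
    ; avoids-edges    = avoids-edges
    }
    where
    start end : Edge pseudoDoubleWheel → Point
    start e = position (toℕ (src e))
    end   e = position (toℕ (tgt e))

    OnArc : Edge pseudoDoubleWheel → Point → Set
    OnArc e = OnPath (start e) (end e ∷ [])

    interior-region : ∀ e {p} → OnArc e p × p ≢ start e × p ≢ end e → Region (proj₂ (piece e)) p
    interior-region e (inj₁ onSegment , p≢start , p≢end) =
      region (proj₂ (piece e)) (openSegment onSegment p≢start p≢end)
    interior-region e (inj₂ p≡end , _ , p≢end) = contradiction p≡end p≢end

    avoids-vertices : ∀ e p → OnArc e p × p ≢ start e × p ≢ end e → ∀ w → p ≢ position (toℕ w)
    avoids-vertices e p interior w p≡w =
      region-avoids-positions (proj₂ (piece e)) (toℕ w)
        (subst (Region (proj₂ (piece e))) p≡w (interior-region e interior))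

    avoids-edges : ∀ e f → e ≢ f → ∀ p → OnArc e p × p ≢ start e × p ≢ end e → ¬ OnArc f p
    avoids-edges e f e≢f p interior onArc
      with u≡ , v≡ ← disjoint (proj₂ (piece e)) (proj₂ (piece f))
             (interior-region e interior)
             (interior-region f
               -- An interior point of e is no vertex, hence no end of f, so it is interior to f
               -- too.
               (onArc , avoids-vertices e p interior (src f) , avoids-vertices e p interior (tgt f)))
      = e≢f (edge-≡ (Fin.toℕ-injective u≡) (Fin.toℕ-injective v≡))

  -- Enumeration of the edges.

  hub : Bool → Fin (6 ℕ.+ m)
  hub true  = suc zero
  hub false = zero

  rim : Fin (4 ℕ.+ m) → Fin (6 ℕ.+ m)
  rim c = suc (suc c)

  joins-spoke : ∀ c b → even (toℕ c) ≡ b → T (joinsFin (hub b) (rim c))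
  joins-spoke c true  eq = from T-≡ eq
  joins-spoke c false eq = from T-not-≡ eq

  joins-rim : ∀ c d → suc (toℕ c) ≡ toℕ d → T (joinsFin (rim c) (rim d))
  joins-rim c d eq = from T-∨ (inj₁ (ℕ.≡⇒≡ᵇ _ _ eq))

  joins-closing : T (joinsFin (rim zero) (rim (fromℕ (3 ℕ.+ m))))
  joins-closing = from T-∨ (inj₂ (ℕ.≡⇒≡ᵇ _ _ (Fin.toℕ-fromℕ (3 ℕ.+ m))))

  -- The left summand lists the spokes by their rim end. The right summand lists the rim edges by
  -- their later end, with `zero` standing for the closing edge.
  Code : Set
  Code = Fin (4 ℕ.+ m) ⊎ Fin (4 ℕ.+ m)

  mkEdge : ∀ u v → T (joinsFin u v) → Edge pseudoDoubleWheel
  mkEdge u v h = record { src = u ; tgt = v ; src<tgt = joinsFin⇒< u v h ; adjacent = joins⇒adj u v h }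

  decode : Code → Edge pseudoDoubleWheel
  decode (inj₁ c)       = mkEdge (hub (even (toℕ c))) (rim c) (joins-spoke c _ refl)
  decode (inj₂ zero)    = mkEdge (rim zero) (rim (fromℕ (3 ℕ.+ m))) joins-closing
  decode (inj₂ (suc c)) = mkEdge (rim (inject₁ c)) (rim (suc c))
    (joins-rim (inject₁ c) (suc c) (cong suc (Fin.toℕ-inject₁ c)))

  -- Defined on all pairs, with `inj₂ zero` as default where there is no edge. An edge between rim
  -- vertices that are not consecutive can only be the closing one.
  encodeEnds : Fin (6 ℕ.+ m) → Fin (6 ℕ.+ m) → Code
  encodeEnds (suc (suc c)) (suc (suc zero))    = inj₂ zero
  encodeEnds (suc (suc c)) (suc (suc (suc d))) with toℕ c ℕ.≟ toℕ d
  ... | yes _ = inj₂ (suc d)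
  ... | no _  = inj₂ zero
  encodeEnds zero          (suc (suc c)) = inj₁ c
  encodeEnds (suc zero)    (suc (suc c)) = inj₁ c
  encodeEnds _             _             = inj₂ zero

  encode : Edge pseudoDoubleWheel → Code
  encode e = encodeEnds (src e) (tgt e)

  encode-decode : ∀ c → encode (decode c) ≡ c
  encode-decode (inj₁ c) with even (toℕ c)
  ... | true  = refl
  ... | false = refl
  encode-decode (inj₂ zero)    with 0 ℕ.≟ toℕ (fromℕ (2 ℕ.+ m))
  ... | no _ = refl
  encode-decode (inj₂ (suc c)) with toℕ (inject₁ c) ℕ.≟ toℕ c
  ... | yes _  = refl
  ... | no c≢c = contradiction (Fin.toℕ-inject₁ c) c≢c

  -- Comparing ends is enough, since `edge-≡` recovers equality of edges from it.
  decode-encodeEnds : ∀ u v → T (joinsFin u v) →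
    src (decode (encodeEnds u v)) ≡ u × tgt (decode (encodeEnds u v)) ≡ v
  decode-encodeEnds zero       (suc (suc c)) h rewrite to T-not-≡ h = refl , refl
  decode-encodeEnds (suc zero) (suc (suc c)) h rewrite to (T-≡ {even (toℕ c)}) h = refl , refl
  decode-encodeEnds (suc (suc c)) (suc (suc (suc d))) h with toℕ c ℕ.≟ toℕ d
  ... | yes c≡d = cong rim (Fin.toℕ-injective (trans (Fin.toℕ-inject₁ d) (sym c≡d))) , refl
  ... | no c≢d with to (T-∨ {toℕ c ≡ᵇ toℕ d}) h
  ...   | inj₁ h′ = contradiction (ℕ.≡ᵇ⇒≡ _ _ h′) c≢d
  ...   | inj₂ h′ with hc , hd ← to (T-∧ {toℕ c ≡ᵇ 0}) h′ =
    cong rim (Fin.toℕ-injective (sym (ℕ.≡ᵇ⇒≡ _ 0 hc)))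
    , cong (λ d → suc (suc (suc d))) (Fin.toℕ-injective
        (trans (Fin.toℕ-fromℕ (2 ℕ.+ m)) (sym (ℕ.≡ᵇ⇒≡ _ _ hd))))
  decode-encodeEnds (suc (suc c)) (suc (suc zero)) h with to (T-∧ {toℕ c ≡ᵇ 0} {false}) h
  ... | ()

  code↔edge : Code ↔ Edge pseudoDoubleWheel
  code↔edge = mk↔ₛ′ decode encode decode-encode encode-decode
    where
    decode-encode : ∀ e → decode (encode e) ≡ e
    decode-encode e
      with u≡ , v≡ ← decode-encodeEnds (src e) (tgt e) (adj⇒joins (src<tgt e) (adjacent e))
      = edge-≡ u≡ v≡

  -- Three-connectedness.

  adj-predecessor : ∀ c → Adj (rim (suc c)) (rim (inject₁ c))
  adj-predecessor c = adj-swap (rim (inject₁ c)) (rim (suc c))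
    (joins⇒adj (rim (inject₁ c)) (rim (suc c))
      (joins-rim (inject₁ c) (suc c) (cong suc (Fin.toℕ-inject₁ c))))

  rimNeighbours : ∀ c → ∃[ p ] ∃[ q ] p ≢ q × Adj (rim c) (rim p) × Adj (rim c) (rim q)
  rimNeighbours zero =
    suc zero , fromℕ (3 ℕ.+ m) , (λ ())
    , joins⇒adj (rim zero) (rim (suc zero)) (joins-rim zero (suc zero) refl)
    , joins⇒adj (rim zero) (rim (fromℕ (3 ℕ.+ m))) joins-closing
  rimNeighbours (suc c) with view c
  ... | ‵fromℕ = zero , inject₁ (fromℕ (2 ℕ.+ m)) , (λ ())
    , adj-swap (rim zero) (rim (fromℕ (3 ℕ.+ m)))
        (joins⇒adj (rim zero) (rim (fromℕ (3 ℕ.+ m))) joins-closing)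
    , adj-predecessor (fromℕ (2 ℕ.+ m))
  ... | ‵inject₁ d = suc (suc d) , inject₁ (inject₁ d)
    -- The successor and the predecessor have indices d + 2 and d.
    , (λ eq → ℕ.<⇒≢ (ℕ.m<n+m (toℕ d) {2} (s≤s z≤n))
        (trans (sym (trans (Fin.toℕ-inject₁ (inject₁ d)) (Fin.toℕ-inject₁ d))) (sym (cong toℕ eq))))
    , joins⇒adj (rim (suc (inject₁ d))) (rim (suc (suc d)))
        (joins-rim (suc (inject₁ d)) (suc (suc d)) (cong (2 ℕ.+_) (Fin.toℕ-inject₁ d)))
    , adj-predecessor (inject₁ d)

-- Deleting x, y and z in turn lowers the cardinality each time.
three∈⇒3≤∣p∣ : ∀ {n} {X : Subset n} {x y z} → x ∈ X → y ∈ X → z ∈ X →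
  x ≢ y → x ≢ z → y ≢ z → 3 ℕ.≤ ∣ X ∣
three∈⇒3≤∣p∣ x∈X y∈X z∈X x≢y x≢z y≢z =
  ℕ.≤-trans (s≤s (ℕ.≤-trans (s≤s (ℕ.≤-trans (s≤s z≤n)
    (x∈p⇒∣p-x∣<∣p∣ (x∈p∧x≢y⇒x∈p-y (x∈p∧x≢y⇒x∈p-y z∈X (x≢z ∘ sym)) (y≢z ∘ sym)))))
    (x∈p⇒∣p-x∣<∣p∣ (x∈p∧x≢y⇒x∈p-y y∈X (x≢y ∘ sym)))))
    (x∈p⇒∣p-x∣<∣p∣ x∈X)

connectedVia : ∀ {n} (G : Graph n) (X : Subset n) r →
  (∀ u → u ∉ X → Star (AdjOutside G X) u r) → ConnectedOutside G X
connectedVia G X r reach u v u∉X v∉X = reach u u∉X ◅◅ reverse swap (reach v v∉X)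
  where
  swap : ∀ {x y} → AdjOutside G X x y → AdjOutside G X y x
  swap {x} {y} (x∉X , y∉X , adj) = y∉X , x∉X , subst T (Graph.adj-sym G x y) adj

-- The pairs {2j , 2j + 1} are disjoint, and ⌊_/2⌋ tells them apart.
untouchedPair : ∀ {n} (X : Subset n) a b → ⌊ toℕ a /2⌋ ≡ ⌊ toℕ b /2⌋ →
  (a ∉ X × b ∉ X) ⊎ (∃[ w ] w ∈ X × ⌊ toℕ w /2⌋ ≡ ⌊ toℕ a /2⌋)
untouchedPair X a b eq with a ∈? X | b ∈? X
... | yes a∈X | _       = inj₂ (a , a∈X , refl)
... | no _    | yes b∈X = inj₂ (b , b∈X , sym eq)
... | no a∉X  | no b∉X  = inj₁ (a∉X , b∉X)

module _ (m : ℕ) (m-even : even m ≡ true) where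

  adj⇒even-flips : ∀ u v → Adj m u v → even (toℕ v) ≡ not (even (toℕ u))
  adj⇒even-flips u v h with to (T-∨ {joinsFin m u v}) h
  ... | inj₁ h′ = joins⇒even-flips (toℕ u) (toℕ v) m-even h′
  ... | inj₂ h′ =
    sym (trans (cong not (joins⇒even-flips (toℕ v) (toℕ u) m-even h′)) (not-involutive _))

  adj-spoke : ∀ c b → even (toℕ c) ≡ b → Adj m (rim m c) (hub m b)
  adj-spoke c b eq =
    adj-swap m (hub m b) (rim m c) (joins⇒adj m (hub m b) (rim m c) (joins-spoke m c b eq))

  hub≢rim : ∀ b c → hub m b ≢ rim m c
  hub≢rim true  c ()
  hub≢rim false c ()

  data HubOrRim (b : Bool) : Fin (6 ℕ.+ m) → Set where
    this  : HubOrRim b (hub m b)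
    other : HubOrRim b (hub m (not b))
    onRim : ∀ c → HubOrRim b (rim m c)

  hubOrRim : ∀ b v → HubOrRim b v
  hubOrRim true  zero          = other
  hubOrRim true  (suc zero)    = this
  hubOrRim false zero          = this
  hubOrRim false (suc zero)    = other
  hubOrRim b     (suc (suc c)) = onRim c

  module _ (X : Subset (6 ℕ.+ m)) (∣X∣<3 : ∣ X ∣ ℕ.< 3) where

    private
      G : Graph (6 ℕ.+ m)
      G = pseudoDoubleWheel m

    no-three : ∀ {x y z} → x ∈ X → y ∈ X → z ∈ X → x ≢ y → x ≢ z → y ≢ z → ⊥
    no-three x∈X y∈X z∈X x≢y x≢z y≢z =
      ℕ.<⇒≱ ∣X∣<3 (three∈⇒3≤∣p∣ x∈X y∈X z∈X x≢y x≢z y≢z)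

    toHub : ∀ b c → hub m b ∉ X → rim m c ∉ X → even (toℕ c) ≡ b →
      Star (AdjOutside G X) (rim m c) (hub m b)
    toHub b c b∉X c∉X eq = (c∉X , b∉X , adj-spoke c b eq) ◅ ε

    connected-oneHub : ∀ b → hub m b ∉ X → hub m (not b) ∈ X → ConnectedOutside G X
    connected-oneHub b b∉X b′∈X = connectedVia G X (hub m b) reach
      where
      -- The vertex c has the wrong parity for the surviving hub; its rim neighbour p has the
      -- opposite parity and is joined to that hub.
      viaRim : ∀ c p → even (toℕ c) ≢ b → rim m c ∉ X → rim m p ∉ X → Adj m (rim m c) (rim m p) →
        Star (AdjOutside G X) (rim m c) (hub m b)
      viaRim c p even≢b c∉X p∉X c~p = (c∉X , p∉X , c~p) ◅ toHub b p b∉X p∉X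
        (trans (adj⇒even-flips (rim m c) (rim m p) c~p) (sym (¬-not (even≢b ∘ sym))))

      reach : ∀ u → u ∉ X → Star (AdjOutside G X) u (hub m b)
      reach u u∉X with hubOrRim b u
      ... | this  = ε
      ... | other = contradiction b′∈X u∉X
      ... | onRim c with even (toℕ c) Bool.≟ b
      ...   | yes eq = toHub b c b∉X u∉X eq
      ...   | no even≢b with p , q , p≢q , c~p , c~q ← rimNeighbours m c
                        with rim m p ∈? X | rim m q ∈? X
      ...     | no p∉X  | _       = viaRim c p even≢b u∉X p∉X c~p
      ...     | yes _   | no q∉X  = viaRim c q even≢b u∉X q∉X c~q
      -- The missing hub and both rim neighbours would be three removed vertices.
      ...     | yes p∈X | yes q∈X = ⊥-elim (no-three b′∈X p∈X q∈X
        (hub≢rim (not b) p) (hub≢rim (not b) q)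
        (p≢q ∘ Fin.suc-injective ∘ Fin.suc-injective))

    connected-noHub : (∀ b → hub m b ∈ X) → ConnectedOutside G X
    connected-noHub hub∈X = connectedVia G X (rim m zero) reach
      where
      rim∉X : ∀ c → rim m c ∉ X
      rim∉X c c∈X = no-three (hub∈X true) (hub∈X false) c∈X (λ ()) (λ ()) (λ ())

      along : ∀ c → Star (AdjOutside G X) (rim m c) (rim m zero)
      along = <-weakInduction (λ c → Star (AdjOutside G X) (rim m c) (rim m zero)) ε
        (λ c path → (rim∉X (suc c) , rim∉X (inject₁ c) , adj-predecessor m c) ◅ path)

      reach : ∀ u → u ∉ X → Star (AdjOutside G X) u (rim m zero)
      reach u u∉X with hubOrRim true u
      ... | this    = contradiction (hub∈X true) u∉X
      ... | other   = contradiction (hub∈X false) u∉X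
      ... | onRim c = along c

    -- Each remaining rim vertex is adjacent to the hub of its own parity, so a walk between the
    -- hubs is all that is missing.
    connected-bothHubs : (∀ b → hub m b ∉ X) →
      Star (AdjOutside G X) (hub m true) (hub m false) → ConnectedOutside G X
    connected-bothHubs hub∉X bridge = connectedVia G X (hub m false) reach
      where
      fromHub : ∀ b → Star (AdjOutside G X) (hub m b) (hub m false)
      fromHub true  = bridge
      fromHub false = ε

      reach : ∀ u → u ∉ X → Star (AdjOutside G X) u (hub m false)
      reach u u∉X with hubOrRim false u
      ... | this    = ε
      ... | other   = bridge
      ... | onRim c = toHub (even (toℕ c)) c (hub∉X _) u∉X refl ◅◅ fromHub (even (toℕ c))

    bridgeVia : ∀ c d → even (toℕ c) ≡ true → suc (toℕ c) ≡ toℕ d → (∀ b → hub m b ∉ X) →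
      rim m c ∉ X × rim m d ∉ X → Star (AdjOutside G X) (hub m true) (hub m false)
    bridgeVia c d c-even eq hub∉X (c∉X , d∉X) =
        (hub∉X true , c∉X , adj-swap m (rim m c) (hub m true) (adj-spoke c true c-even))
      ◅ (c∉X , d∉X , joins⇒adj m (rim m c) (rim m d) (joins-rim m c d eq))
      ◅ toHub false d (hub∉X false) d∉X
          (trans (cong even (sym eq)) (trans (even-suc (toℕ c)) (cong not c-even)))

-- The shift by 2 gives the rim at least six vertices, enough for three disjoint paths between the
-- hubs.
threeConnected : ∀ m → even m ≡ true → IsVertexConnected 3 (pseudoDoubleWheel (2 ℕ.+ m))
threeConnected m m-even = s≤s (s≤s (s≤s (s≤s z≤n))) , connected
  where
  connected : ∀ X → ∣ X ∣ ℕ.< 3 → ConnectedOutside (pseudoDoubleWheel (2 ℕ.+ m)) X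
  connected X ∣X∣<3 with hub (2 ℕ.+ m) true ∈? X | hub (2 ℕ.+ m) false ∈? X
  ... | yes t∈X | yes f∈X = connected-noHub (2 ℕ.+ m) m-even X ∣X∣<3 λ { true → t∈X ; false → f∈X }
  ... | yes t∈X | no f∉X  = connected-oneHub (2 ℕ.+ m) m-even X ∣X∣<3 false f∉X t∈X
  ... | no t∉X  | yes f∈X = connected-oneHub (2 ℕ.+ m) m-even X ∣X∣<3 true t∉X f∈X
  ... | no t∉X  | no f∉X  = connected-bothHubs (2 ℕ.+ m) m-even X ∣X∣<3 hub∉X bridge
    where
    hub∉X : ∀ b → hub (2 ℕ.+ m) b ∉ X
    hub∉X true  = t∉X
    hub∉X false = f∉X

    bridge : Star (AdjOutside (pseudoDoubleWheel (2 ℕ.+ m)) X) (suc zero) zero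
    -- Vertices 2 to 7 are c₀ to c₅. If all three pairs were touched, the halves 1, 2, 3 would show
    -- three distinct removed vertices.
    bridge with untouchedPair X (# 2) (# 3) refl
            | untouchedPair X (# 4) (# 5) refl
            | untouchedPair X (# 6) (# 7) refl
    ... | inj₁ free | _ | _ = bridgeVia (2 ℕ.+ m) m-even X ∣X∣<3 (# 0) (# 1) refl refl hub∉X free
    ... | inj₂ _ | inj₁ free | _ = bridgeVia (2 ℕ.+ m) m-even X ∣X∣<3 (# 2) (# 3) refl refl hub∉X free
    ... | inj₂ _ | inj₂ _ | inj₁ free = bridgeVia (2 ℕ.+ m) m-even X ∣X∣<3 (# 4) (# 5) refl refl hub∉X free
    ... | inj₂ (x , x∈X , x≡) | inj₂ (y , y∈X , y≡) | inj₂ (z , z∈X , z≡) =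
      ⊥-elim (no-three (2 ℕ.+ m) m-even X ∣X∣<3 x∈X y∈X z∈X
        (λ { refl → case trans (sym x≡) y≡ of λ () })
        (λ { refl → case trans (sym x≡) z≡ of λ () })
        (λ { refl → case trans (sym y≡) z≡ of λ () }))

-- Class sizes, edge count and conclusion.

evens : ∀ n → Subset n
evens n = tabulate (even ∘ toℕ)

-- Each step of `double` adds one vertex of either parity, and `even` computes through the shift by
-- two.
∣evens∣ : ∀ k → ∣ evens (double k) ∣ ≡ k
∣evens∣ zero    = refl
∣evens∣ (suc k) = cong suc (∣evens∣ k)

∣∁evens∣ : ∀ k → ∣ ∁ (evens (double k)) ∣ ≡ k
∣∁evens∣ zero    = refl
∣∁evens∣ (suc k) = cong suc (∣∁evens∣ k)

even⇒∈evens : ∀ {n} (v : Fin n) → even (toℕ v) ≡ true → v ∈ evens n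
even⇒∈evens v eq = lookup⇒[]= v _ (trans (lookup∘tabulate _ v) eq)

odd⇒∈∁evens : ∀ {n} (v : Fin n) → even (toℕ v) ≡ false → v ∈ ∁ (evens n)
odd⇒∈∁evens v eq = x∉p⇒x∈∁p λ v∈ →
  case trans (sym eq) (trans (sym (lookup∘tabulate _ v)) ([]=⇒lookup v∈)) of λ ()

evens-bipartition : ∀ m → even m ≡ true → IsBipartition (pseudoDoubleWheel m) (evens (6 ℕ.+ m))
evens-bipartition m m-even u v adj with even (toℕ u) in u-parity | adj⇒even-flips m m-even u v adj
... | true  | v-parity = inj₁ (even⇒∈evens u u-parity , odd⇒∈∁evens v v-parity)
... | false | v-parity = inj₂ (odd⇒∈∁evens u u-parity , even⇒∈evens v v-parity)

double≡+ : ∀ n → double n ≡ n ℕ.+ n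
double≡+ zero    = refl
double≡+ (suc n) = cong suc (trans (cong suc (double≡+ n)) (sym (ℕ.+-suc n n)))

-- For k = 4 + r the rim has 2k - 2 = 6 + 2r vertices, hence that many spokes and as many rim edges.
edgeCount : ∀ r → (6 ℕ.+ double r) ℕ.+ (6 ℕ.+ double r) ≡ 4 ℕ.* (4 ℕ.+ r) ∸ 4
edgeCount r = begin
  (6 ℕ.+ double r) ℕ.+ (6 ℕ.+ double r) ≡⟨ cong (λ d → (6 ℕ.+ d) ℕ.+ (6 ℕ.+ d)) (double≡+ r) ⟩
  (6 ℕ.+ (r ℕ.+ r)) ℕ.+ (6 ℕ.+ (r ℕ.+ r))
    ≡⟨ solve 1 (λ r → (con 6 :+ (r :+ r)) :+ (con 6 :+ (r :+ r)) := con 12 :+ con 4 :* r) refl r ⟩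
  12 ℕ.+ 4 ℕ.* r ≡⟨ cong (_∸ 4) (ℕ.*-distribˡ-+ 4 4 r) ⟨
  4 ℕ.* (4 ℕ.+ r) ∸ 4 ∎
  where
  open ≡-Reasoning
  open ℕ-Solver

proposition5p3 : ∀ (k : ℕ) → k ≥ 4 →
    ∃[ n ] Σ[ G ∈ Graph n ]
    IsPolyhedral G ×
    (Σ[ A ∈ Subset n ] IsBipartition G A × ∣ A ∣ ≡ k × ∣ ∁ A ∣ ≡ k) ×
    (Fin (4 * k ∸ 4) ↔ Edge G)
proposition5p3 (suc (suc (suc (suc r)))) (s≤s (s≤s (s≤s (s≤s z≤n)))) =
    8 ℕ.+ double r , pseudoDoubleWheel m
  , (planar m , threeConnected (double r) (even-double r))
  , (evens _ , evens-bipartition m (even-double r) , ∣evens∣ (4 ℕ.+ r) , ∣∁evens∣ (4 ℕ.+ r))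
  , subst (λ count → Fin count ↔ Edge (pseudoDoubleWheel m)) (edgeCount r)
      (code↔edge m ↔-∘ Fin.+↔⊎)
  where
  -- Chosen so that 6 + m = 2k.
  m : ℕ
  m = 2 ℕ.+ double r
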